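{- The non Desargues complex $\mathcal{N}=(E,N)$ admits no proper matroid extension.
   Context: Let $K_5$ be the complete graph on $\{1,2,3,4,5\}$ and $E$ its set of edges (2-subsets, written $ab$). Let $D$ be the set of all edge sets of subforests of $K_5$ with at most $3$ edges, let $L_0=\{34,35,45\}$, and set $N=D\cup\{L_0\}$; the non Desargues complex is $\mathcal{N}=(E,N)$, a simplicial complex of dimension $2$. A simplicial complex is a pair $(V,H)$ with $V$ finite nonempty, $H\subseteq 2^V$ containing all singletons and closed under subsets; its dimension is $\max\{|X|:X\in H\}-1$; it is a matroid if for all $I,J\in H$ with $|I|=|J|+1$ there is $i\in I\setminus J$ with $J\cup\{i\}\in H$. An extension of a complex $(V,H)$ of dimension $d$ is a complex $(V,H')$ with $H'\cap P_{\le d+1}(V)=H$, where $P_{\le k}(V)$ is the set of subsets with at most $k$ elements; it is proper if $H'\ne H$. -}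

module Defs where

open import Data.Nat using (ℕ; suc; _≤_)
open import Data.Fin using (Fin; zero; suc)
open import Data.Fin.Subset using (Subset; _∈_; _∉_; _⊆_; _∪_; ⁅_⁆; ∣_∣; ⊥)
open import Data.Vec using (_∷_; [])
open import Data.Bool using (true; false)
open import Data.List using (List; []; _∷_; _++_; [_]; length)
open import Data.List.Relation.Unary.Unique.Propositional using (Unique)
open import Data.Product using (_×_; _,_; ∃)
open import Data.Sum using (_⊎_)
open import Relation.Nullary using (¬_)
open import Relation.Binary.PropositionalEquality using (_≡_)
open import Function.Bundles using (_⇔_)

IsSimplicialComplex : ∀ {n} → (Subset n → Set) → Set
IsSimplicialComplex {n} H =
  (∀ (i : Fin n) → H ⁅ i ⁆) × (∀ (X Y : Subset n) → Y ⊆ X → H X → H Y)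

IsMatroid : ∀ {n} → (Subset n → Set) → Set
IsMatroid {n} H =
  ∀ (I J : Subset n) → H I → H J → ∣ I ∣ ≡ suc ∣ J ∣ →
    ∃ λ (i : Fin n) → i ∈ I × i ∉ J × H (J ∪ ⁅ i ⁆)

IsExtension : ∀ {n} → ℕ → (Subset n → Set) → (Subset n → Set) → Set
IsExtension {n} d H H' = ∀ (X : Subset n) → ∣ X ∣ ≤ suc d → (H' X ⇔ H X)

IsProper : ∀ {n} → (Subset n → Set) → (Subset n → Set) → Set
IsProper {n} H H' = ¬ (∀ (X : Subset n) → (H' X ⇔ H X))

-- K5: vertices Fin 5 (vertex k+1 of the paper is Fin index k),
-- edges Fin 10 enumerated as 12,13,14,15,23,24,25,34,35,45.

V5 : Set
V5 = Fin 5

E : Set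
E = Fin 10

v1 v2 v3 v4 v5 : V5
v1 = zero
v2 = suc zero
v3 = suc (suc zero)
v4 = suc (suc (suc zero))
v5 = suc (suc (suc (suc zero)))

ends : E → V5 × V5
ends zero = (v1 , v2)
ends (suc zero) = (v1 , v3)
ends (suc (suc zero)) = (v1 , v4)
ends (suc (suc (suc zero))) = (v1 , v5)
ends (suc (suc (suc (suc zero)))) = (v2 , v3)
ends (suc (suc (suc (suc (suc zero))))) = (v2 , v4)
ends (suc (suc (suc (suc (suc (suc zero)))))) = (v2 , v5)
ends (suc (suc (suc (suc (suc (suc (suc zero))))))) = (v3 , v4)
ends (suc (suc (suc (suc (suc (suc (suc (suc zero)))))))) = (v3 , v5)
ends (suc (suc (suc (suc (suc (suc (suc (suc (suc zero))))))))) = (v4 , v5)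

Adjacent : Subset 10 → V5 → V5 → Set
Adjacent F u v = ∃ λ (e : E) → e ∈ F × (ends e ≡ (u , v) ⊎ ends e ≡ (v , u))

AdjChain : Subset 10 → List V5 → Set
AdjChain F [] = Data.Unit.⊤ where import Data.Unit
AdjChain F (x ∷ []) = Data.Unit.⊤ where import Data.Unit
AdjChain F (x ∷ y ∷ xs) = Adjacent F x y × AdjChain F (y ∷ xs)

HasCycle : Subset 10 → Set
HasCycle F = ∃ λ (v : V5) → ∃ λ (vs : List V5) →
  2 ≤ length vs × Unique (v ∷ vs) × AdjChain F (v ∷ vs ++ [ v ])

IsForest : Subset 10 → Set
IsForest F = ¬ HasCycle F

D : Subset 10 → Set
D F = IsForest F × ∣ F ∣ ≤ 3

-- L0 = {34, 35, 45}  (indices 7, 8, 9)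
L0 : Subset 10
L0 = false ∷ false ∷ false ∷ false ∷ false ∷ false ∷ false ∷ true ∷ true ∷ true ∷ []

N : Subset 10 → Set
N F = D F ⊎ F ≡ L0

{-# OPTIONS --safe #-}
module Submission where

-- If a matroid extension had an independent set of rank 4, every independent
-- 3-set would be augmentable from it.  The planes spanned by K₄ on {1,3,4,5}
-- and by K₄ on {2,3,4,5} both contain L₀, which is independent, so they
-- coincide with the flat spanned by L₀; this flat then contains 13 and 23,
-- hence 12, hence every edge, and L₀ would be a basis.  The augmentations are
-- played out on the stars {13,14,15}, {23,24,25} and {13,23,34}, which are
-- forests, and each of them produces a triangle other than L₀.

open import Defs
open import Data.Bool using (true; false)
open import Data.Empty using (⊥-elim)
open import Data.Fin using (#_)
open import Data.Fin.Properties using (_≟_; all?; any?)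
open import Data.Fin.Subset using (Subset; _∈_; _∉_; _⊆_; _∪_; ⁅_⁆; ∣_∣; ⊥)
open import Data.Fin.Subset.Properties using (_∈?_; _⊆?_; ⊥⊆; ∣⊥∣≡0; s⊆s)
open import Data.List using (List; []; _∷_; _++_; [_]; foldr)
open import Data.List.Relation.Unary.All as All using (All; []; _∷_)
open import Data.List.Relation.Unary.AllPairs using (_∷_)
open import Data.List.Relation.Unary.Any as Any using (Any)
open import Data.List.Membership.Propositional using (find)
open import Data.List.Relation.Unary.Unique.Propositional using (Unique)
open import Data.List.Relation.Unary.Unique.DecPropositional (_≟_ {5}) using (unique?)
open import Data.Nat using (zero; suc; _≤_; z≤n; s≤s)
import Data.Nat.Properties as ℕ
open import Data.Product using (_×_; _,_; ∃; proj₂)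
import Data.Product.Properties as Product
open import Data.Sum using (_⊎_; inj₁; inj₂; [_,_]′)
open import Data.Unit using (tt)
import Data.Vec as Vec
import Data.Vec.Properties as Vec
import Data.Bool.Properties as Bool
open import Function.Bundles using (mk⇔; Equivalence)
open import Relation.Binary.PropositionalEquality using (_≡_; _≢_; refl; sym; trans; cong; subst)
open import Relation.Nullary using (¬_; Dec)
open import Relation.Nullary.Decidable using (_×-dec_; _⊎-dec_; _→-dec_; ¬?; toWitness)

subset-of-size : ∀ {n} k (X : Subset n) → k ≤ ∣ X ∣ → ∃ λ Y → Y ⊆ X × ∣ Y ∣ ≡ k
subset-of-size {n} zero X _ = ⊥ , ⊥⊆ , ∣⊥∣≡0 n
subset-of-size (suc k) (true Vec.∷ X) (s≤s k≤) =
  let Y , Y⊆X , ∣Y∣≡k = subset-of-size k X k≤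
  in true Vec.∷ Y , s⊆s Y⊆X , cong suc ∣Y∣≡k
subset-of-size (suc k) (false Vec.∷ X) k≤ =
  let Y , Y⊆X , ∣Y∣≡k = subset-of-size (suc k) X k≤
  in false Vec.∷ Y , s⊆s Y⊆X , ∣Y∣≡k

Incident : V5 → V5 × V5 → Set
Incident c (u , v) = u ≡ c ⊎ v ≡ c

incident? : ∀ c p → Dec (Incident c p)
incident? c (u , v) = (u ≟ c) ⊎-dec (v ≟ c)

IsStar : V5 → Subset 10 → Set
IsStar c F = ∀ e → e ∈ F → Incident c (ends e)

isStar? : ∀ c F → Dec (IsStar c F)
isStar? c F = all? λ e → (e ∈? F) →-dec incident? c (ends e)

module _ {c F} (star : IsStar c F) where

  adjacent-incident : ∀ {u v} → Adjacent F u v → Incident c (u , v)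
  adjacent-incident (e , e∈F , inj₁ eq) with ends e | star e e∈F | eq
  ... | _ | inc | refl = inc
  adjacent-incident (e , e∈F , inj₂ eq) with ends e | star e e∈F | eq
  ... | _ | inj₁ p | refl = inj₂ p
  ... | _ | inj₂ p | refl = inj₁ p

  centre-unless-left : ∀ {u v} → Adjacent F u v → u ≢ c → v ≡ c
  centre-unless-left adj u≢c with adjacent-incident adj
  ... | inj₁ u≡c = ⊥-elim (u≢c u≡c)
  ... | inj₂ v≡c = v≡c

  -- Of three consecutive edges of a cycle, the first two force their common
  -- vertex to be the centre, and the third then misses it.
  star⇒forest : IsForest F
  star⇒forest (v , [] , () , _)
  star⇒forest (v , _ ∷ [] , s≤s () , _)
  star⇒forest (v , a ∷ b ∷ vs , _ , (v≢a ∷ v≢b ∷ _) ∷ (a≢b ∷ a≢vs) ∷ _ , va , ab , rest) =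
    missed vs a≢vs rest
    where
    a≡c : a ≡ c
    a≡c with adjacent-incident va
    ... | inj₂ a≡c = a≡c
    ... | inj₁ refl = ⊥-elim (v≢b (sym (centre-unless-left ab λ a≡c → v≢a (sym a≡c))))

    b≢c : b ≢ c
    b≢c b≡c = a≢b (trans a≡c (sym b≡c))

    missed : ∀ ws → All (a ≢_) ws → ¬ AdjChain F (b ∷ ws ++ [ v ])
    missed [] _ (bv , _) = v≢a (trans (centre-unless-left bv b≢c) (sym a≡c))
    missed (w ∷ _) (a≢w ∷ _) (bw , _) = a≢w (trans a≡c (sym (centre-unless-left bw b≢c)))

adjacent? : ∀ F u v → Dec (Adjacent F u v)
adjacent? F u v = any? λ e → (e ∈? F) ×-dec ((ends e ≟ₚ (u , v)) ⊎-dec (ends e ≟ₚ (v , u)))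
  where _≟ₚ_ = Product.≡-dec _≟_ _≟_

edge-set : List E → Subset 10
edge-set = foldr (λ e F → ⁅ e ⁆ ∪ F) ⊥

e12 e13 e14 e15 e23 e24 e25 e34 e35 e45 : E
e12 = # 0
e13 = # 1
e14 = # 2
e15 = # 3
e23 = # 4
e24 = # 5
e25 = # 6
e34 = # 7
e35 = # 8
e45 = # 9

star₁ star₂ star₃ : Subset 10
star₁ = edge-set (e13 ∷ e14 ∷ e15 ∷ [])
star₂ = edge-set (e23 ∷ e24 ∷ e25 ∷ [])
star₃ = edge-set (e13 ∷ e23 ∷ e34 ∷ [])

-- Exactly the triangles closed when `star₁`, `star₂` or `star₃` is augmented by an edge of the K₄
-- that it spans. `L0` is a triangle as well, but it belongs to `N` and so must stay off the list.
triangles : List (Subset 10)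
triangles =
  edge-set (e12 ∷ e13 ∷ e23 ∷ []) ∷
  edge-set (e13 ∷ e14 ∷ e34 ∷ []) ∷
  edge-set (e13 ∷ e15 ∷ e35 ∷ []) ∷
  edge-set (e14 ∷ e15 ∷ e45 ∷ []) ∷
  edge-set (e23 ∷ e24 ∷ e34 ∷ []) ∷
  edge-set (e23 ∷ e25 ∷ e35 ∷ []) ∷
  edge-set (e24 ∷ e25 ∷ e45 ∷ []) ∷ []

-- Quantifying over three vertices, where `HasCycle` quantifies over lists, makes this decidable by
-- enumeration.
ContainsTriangle : Subset 10 → Set
ContainsTriangle F = ∃ λ u → ∃ λ v → ∃ λ w →
  Unique (u ∷ v ∷ w ∷ []) × Adjacent F u v × Adjacent F v w × Adjacent F w u

containsTriangle? : ∀ F → Dec (ContainsTriangle F)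
containsTriangle? F = any? λ u → any? λ v → any? λ w →
  unique? (u ∷ v ∷ w ∷ []) ×-dec adjacent? F u v ×-dec adjacent? F v w ×-dec adjacent? F w u

containsTriangle⇒hasCycle : ∀ {F} → ContainsTriangle F → HasCycle F
containsTriangle⇒hasCycle (u , v , w , distinct , uv , vw , wu) =
  u , v ∷ w ∷ [] , s≤s (s≤s z≤n) , distinct , uv , vw , wu , tt

triangles-valid : All (λ T → ContainsTriangle T × ∣ T ∣ ≤ 3 × T ≢ L0) triangles
triangles-valid = toWitness {a? = All.all? (λ T →
  containsTriangle? T ×-dec (∣ T ∣ ℕ.≤? 3) ×-dec ¬? (Vec.≡-dec Bool._≟_ T L0)) triangles} tt

Dependent : Subset 10 → Set
Dependent F = Any (_⊆ F) triangles

dependent? : ∀ F → Dec (Dependent F)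
dependent? F = Any.any? (_⊆? F) triangles

-- A decidable certificate that `I` and `J` cannot both be independent: every exchange from `I` into
-- `J` closes a listed triangle.
Unaugmentable : Subset 10 → Subset 10 → Set
Unaugmentable I J = ∣ I ∣ ≡ suc ∣ J ∣ × (∀ i → i ∈ I → i ∉ J → Dependent (J ∪ ⁅ i ⁆))

unaugmentable? : ∀ I J → Dec (Unaugmentable I J)
unaugmentable? I J = (∣ I ∣ ℕ.≟ suc ∣ J ∣) ×-dec
  all? λ i → (i ∈? I) →-dec ¬? (i ∈? J) →-dec dependent? (J ∪ ⁅ i ⁆)

-- Every edge outside `L0` other than 12 joins 1 or 2 to one of 3, 4, 5. If it starts at 1, then
-- `L0 ∪ ⁅ j ⁆` lies in the K₄ on {1,3,4,5}, where `star₁` is a spanning tree, so any further edge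
-- closes a triangle at 1; likewise for 2 and `star₂`.
planes-unaugmentable : ∀ j → j ∉ L0 → j ≢ e12 →
  Unaugmentable (L0 ∪ ⁅ j ⁆) star₁ ⊎ Unaugmentable (L0 ∪ ⁅ j ⁆) star₂
planes-unaugmentable = toWitness {a? = all? λ j → ¬? (j ∈? L0) →-dec ¬? (j ≟ e12) →-dec
  (unaugmentable? (L0 ∪ ⁅ j ⁆) star₁ ⊎-dec unaugmentable? (L0 ∪ ⁅ j ⁆) star₂)} tt

-- 12 closes the triangle 123 with star₃, so augmenting star₃ yields a 4-set avoiding 12.
star₃-augmentations : ∀ i → i ∉ star₃ →
  Dependent (star₃ ∪ ⁅ i ⁆) ⊎ (∣ star₃ ∪ ⁅ i ⁆ ∣ ≡ 4 × e12 ∉ star₃ ∪ ⁅ i ⁆)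
star₃-augmentations = toWitness {a? = all? λ i → ¬? (i ∈? star₃) →-dec
  (dependent? (star₃ ∪ ⁅ i ⁆) ⊎-dec
    ((∣ star₃ ∪ ⁅ i ⁆ ∣ ℕ.≟ 4) ×-dec ¬? (e12 ∈? star₃ ∪ ⁅ i ⁆)))} tt

N⇒size≤3 : ∀ {X} → N X → ∣ X ∣ ≤ 3
N⇒size≤3 (inj₁ (_ , ≤3)) = ≤3
N⇒size≤3 (inj₂ refl) = ℕ.≤-refl

module _ {H' : Subset 10 → Set} (complex : IsSimplicialComplex H')
         (extension : IsExtension 2 N H') (matroid : IsMatroid H') where

  -- Up to size 3 the extension agrees with `N`, whose only member with a cycle is `L0`.
  triangle⇒¬H' : ∀ {T} → ContainsTriangle T → ∣ T ∣ ≤ 3 → T ≢ L0 → ¬ H' T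
  triangle⇒¬H' {T} triangle ≤3 T≢L0 H'T with Equivalence.to (extension T ≤3) H'T
  ... | inj₁ (forest , _) = forest (containsTriangle⇒hasCycle triangle)
  ... | inj₂ T≡L0 = T≢L0 T≡L0

  dependent⇒¬H' : ∀ F → Dependent F → ¬ H' F
  dependent⇒¬H' F dep H'F =
    let T , T∈ , T⊆F = find dep
        triangle , ≤3 , T≢L0 = All.lookup triangles-valid T∈
    in triangle⇒¬H' triangle ≤3 T≢L0 (proj₂ complex F T T⊆F H'F)

  star⇒H' : ∀ c F → IsStar c F → ∣ F ∣ ≤ 3 → H' F
  star⇒H' c F star ≤3 = Equivalence.from (extension F ≤3) (inj₁ (star⇒forest star , ≤3))

  unaugmentable⇒¬H' : ∀ I J → Unaugmentable I J → H' J → ¬ H' I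
  unaugmentable⇒¬H' I J (size , stuck) H'J H'I =
    let i , i∈I , i∉J , H'J∪i = matroid I J H'I H'J size
    in dependent⇒¬H' (J ∪ ⁅ i ⁆) (stuck i i∈I i∉J) H'J∪i

  H'-L0 : H' L0
  H'-L0 = Equivalence.from (extension L0 ℕ.≤-refl) (inj₂ refl)

  H'-star₁ : H' star₁
  H'-star₁ = star⇒H' v1 star₁ (toWitness {a? = isStar? v1 star₁} tt) ℕ.≤-refl

  H'-star₂ : H' star₂
  H'-star₂ = star⇒H' v2 star₂ (toWitness {a? = isStar? v2 star₂} tt) ℕ.≤-refl

  H'-star₃ : H' star₃
  H'-star₃ = star⇒H' v3 star₃ (toWitness {a? = isStar? v3 star₃} tt) ℕ.≤-refl

  -- Augmenting `L0` from `I` adds an edge other than 12, which puts an independent 4-set inside one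
  -- of the two planes through `L0`.
  ¬H'-size4-avoiding-12 : ∀ I → ∣ I ∣ ≡ 4 → e12 ∉ I → ¬ H' I
  ¬H'-size4-avoiding-12 I size 12∉I H'I =
    let j , j∈I , j∉L0 , H'L0∪j = matroid I L0 H'I H'-L0 size
        L0∪j = L0 ∪ ⁅ j ⁆
    in [ (λ stuck → unaugmentable⇒¬H' L0∪j star₁ stuck H'-star₁ H'L0∪j)
       , (λ stuck → unaugmentable⇒¬H' L0∪j star₂ stuck H'-star₂ H'L0∪j)
       ]′ (planes-unaugmentable j j∉L0 λ j≡12 → 12∉I (subst (_∈ I) j≡12 j∈I))

  -- Since `I` may contain 12, it is first traded for an independent 4-set without 12, obtained by
  -- augmenting `star₃` from `I`.
  ¬H'-size4 : ∀ I → ∣ I ∣ ≡ 4 → ¬ H' I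
  ¬H'-size4 I size H'I =
    let i , _ , i∉ , H'star₃∪i = matroid I star₃ H'I H'-star₃ size
        star₃∪i = star₃ ∪ ⁅ i ⁆
    in [ (λ dep → dependent⇒¬H' star₃∪i dep H'star₃∪i)
       , (λ (size′ , 12∉) → ¬H'-size4-avoiding-12 star₃∪i size′ 12∉ H'star₃∪i)
       ]′ (star₃-augmentations i i∉)

  H'⇒size≤3 : ∀ {X} → H' X → ∣ X ∣ ≤ 3
  H'⇒size≤3 {X} H'X = ℕ.≮⇒≥ λ 4≤ →
    -- Closure under subsets reduces any larger independent set to one of size exactly 4.
    let Y , Y⊆X , size = subset-of-size 4 X 4≤
    in ¬H'-size4 Y size (proj₂ complex X Y Y⊆X H'X)

theorem9p5 : ∀ (H' : Subset 10 → Set) →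
    IsSimplicialComplex H' → IsExtension 2 N H' → IsProper N H' → ¬ IsMatroid H'
-- Properness fails because `H'` and `N` agree up to size 3 and neither has a larger member.
theorem9p5 H' complex extension proper matroid = proper λ X → mk⇔
  (λ H'X → Equivalence.to (extension X (H'⇒size≤3 complex extension matroid H'X)) H'X)
  (λ NX → Equivalence.from (extension X (N⇒size≤3 NX)) NX)
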